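{- Every Hintikka formula $H$ of $\mathbf{L_1}$ satisfies $\dashv_H H$.
   Context: Formulas of $\mathbf{L_1}$: built from atomic formulas $\epsilon ab$ ($a,b$ name variables from a countably infinite list, possibly equal) with primitive connectives $\vee,\sim$; $\wedge,\supset,\equiv$ defined as usual. Disjunctions may be associated in any way. $\vdash_H A$: $A$ belongs to the smallest set containing all instances of classical propositional tautologies and all formulas $\epsilon ab\supset\epsilon aa$, $(\epsilon ab\wedge\epsilon bc)\supset\epsilon ac$, $(\epsilon ab\wedge\epsilon bb)\supset\epsilon ba$, closed under modus ponens. Positive/negative parts (occurrences): $A$ is a positive part of $A$; if $B\vee C$ is a positive part then $B,C$ are positive parts; if $\sim B$ is a positive part then $B$ is a negative part; if $\sim B$ is a negative part then $B$ is a positive part. $F[B_+,B_-]$ denotes a formula in which some formula $B$ has one occurrence as a positive part and another (non-overlapping) occurrence as a negative part. Hintikka formula: a formula $H$ such that (1) $H$ is not of the form $F[B_+,B_-]$; (2) if $B\vee C$ is a negative part of $H$ then $B$ or $C$ is; (3) if $\epsilon ab$ is a negative part then so is $\epsilon aa$; (4) if $\epsilon ab,\epsilon bc$ are negative parts then so is $\epsilon ac$; (5) if $\epsilon ab,\epsilon bb$ are negative parts then so is $\epsilon ba$. $\mathbf{HAR}$: fix a name variable $a_0$; $\dashv_H$ is the smallest set such that $\dashv_H\epsilon a_0a_0$; $\dashv_H\sim\epsilon a_0a_0$; if $\vdash_H A\supset B$ and $\dashv_H B$ then $\dashv_H A$; if $\dashv_H A$ and $A$ is obtained from $B$ by uniform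 substitution of name variables for name variables then $\dashv_H B$; if $A$ is a Hintikka formula that is a disjunction of atomic or negated atomic formulas, $\dashv_H A$, and $\epsilon ab$ is not a negative part of $A$, then $\dashv_H A\vee\epsilon ab$. -}

module Defs where

open import Data.Bool.Base as Bool using (Bool; true)
open import Data.Nat.Base using (ℕ)
open import Data.Product.Base using (_×_; _,_; Σ-syntax; ∃-syntax)
open import Data.Sum.Base using (_⊎_)
open import Relation.Binary.PropositionalEquality.Core using (_≡_)
open import Relation.Nullary.Negation.Core using (¬_)

infix  9 ∼_
infixl 7 _∧_
infixl 6 _∨_
infixr 5 _⊃_

-- Formulas over an arbitrary set X of atoms.  X = ℕ gives the classical
-- propositional language, X = Name × Name gives the language L₁.

data Formula (X : Set) : Set where
  atom : X → Formula X
  _∨_  : Formula X → Formula X → Formula X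
  ∼_   : Formula X → Formula X

_∧_ _⊃_ : ∀ {X} → Formula X → Formula X → Formula X
A ∧ B = ∼ (∼ A ∨ ∼ B)
A ⊃ B = ∼ A ∨ B

substitute : ∀ {X Y} → (X → Formula Y) → Formula X → Formula Y
substitute σ (atom x) = σ x
substitute σ (A ∨ B)  = substitute σ A ∨ substitute σ B
substitute σ (∼ A)    = ∼ substitute σ A

eval : ∀ {X} → (X → Bool) → Formula X → Bool
eval v (atom x) = v x
eval v (A ∨ B)  = eval v A Bool.∨ eval v B
eval v (∼ A)    = Bool.not (eval v A)

Tautology : Formula ℕ → Set
Tautology P = ∀ v → eval v P ≡ true

Name : Set
Name = ℕ

L₁ : Set
L₁ = Formula (Name × Name)

pattern ε a b = atom (a , b)

rename : (Name → Name) → L₁ → L₁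
rename ρ = substitute λ (a , b) → ε (ρ a) (ρ b)

infix 4 ⊢_

data ⊢_ : L₁ → Set where
  taut : ∀ P → Tautology P → (σ : ℕ → L₁) → ⊢ substitute σ P
  ax₁  : ∀ a b → ⊢ ε a b ⊃ ε a a
  ax₂  : ∀ a b c → ⊢ (ε a b ∧ ε b c) ⊃ ε a c
  ax₃  : ∀ a b → ⊢ (ε a b ∧ ε b b) ⊃ ε b a
  mp   : ∀ {A B} → ⊢ A ⊃ B → ⊢ A → ⊢ B

data Sign : Set where
  pos neg : Sign

-- The elements of Part H pos B (resp. Part H neg B) are the occurrences of B
-- in H as a positive (resp. negative) part.  A negative disjunction is not
-- decomposed any further.

data Part (H : L₁) : Sign → L₁ → Set where
  whole : Part H pos H
  ∨ˡ    : ∀ {B C} → Part H pos (B ∨ C) → Part H pos B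
  ∨ʳ    : ∀ {B C} → Part H pos (B ∨ C) → Part H pos C
  ∼⁺    : ∀ {B} → Part H pos (∼ B) → Part H neg B
  ∼⁻    : ∀ {B} → Part H neg (∼ B) → Part H pos B

PosPart NegPart : L₁ → L₁ → Set
PosPart B H = Part H pos B
NegPart B H = Part H neg B

-- p ⊑ q : the occurrence p lies inside (or is) the occurrence q.

infix 4 _⊑_

data _⊑_ {H : L₁} : ∀ {s t B C} → Part H s B → Part H t C → Set where
  ⊑-refl : ∀ {s B} {p : Part H s B} → p ⊑ p
  ⊑-∨ˡ   : ∀ {t B C D} {p : Part H pos (B ∨ C)} {q : Part H t D} → p ⊑ q → ∨ˡ p ⊑ q
  ⊑-∨ʳ   : ∀ {t B C D} {p : Part H pos (B ∨ C)} {q : Part H t D} → p ⊑ q → ∨ʳ p ⊑ q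
  ⊑-∼⁺   : ∀ {t B D} {p : Part H pos (∼ B)} {q : Part H t D} → p ⊑ q → ∼⁺ p ⊑ q
  ⊑-∼⁻   : ∀ {t B D} {p : Part H neg (∼ B)} {q : Part H t D} → p ⊑ q → ∼⁻ p ⊑ q

-- Formulas are trees, so two occurrences overlap iff one lies inside the other.

Overlap : ∀ {H s t B C} → Part H s B → Part H t C → Set
Overlap p q = p ⊑ q ⊎ q ⊑ p

-- H is of the form F[B₊,B₋].

Clash : L₁ → Set
Clash H = ∃[ B ] Σ[ p ∈ PosPart B H ] Σ[ q ∈ NegPart B H ] ¬ Overlap p q

record Hintikka (H : L₁) : Set where
  field
    no-clash : ¬ Clash H
    neg-∨    : ∀ B C → NegPart (B ∨ C) H → NegPart B H ⊎ NegPart C H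
    neg-ε₁   : ∀ a b → NegPart (ε a b) H → NegPart (ε a a) H
    neg-ε₂   : ∀ a b c → NegPart (ε a b) H → NegPart (ε b c) H → NegPart (ε a c) H
    neg-ε₃   : ∀ a b → NegPart (ε a b) H → NegPart (ε b b) H → NegPart (ε b a) H

-- Disjunctions, associated in any way, of one or more atomic or negated atomic
-- formulas.

data LiteralDisjunction : L₁ → Set where
  lit⁺ : ∀ a b → LiteralDisjunction (ε a b)
  lit⁻ : ∀ a b → LiteralDisjunction (∼ ε a b)
  _∨_  : ∀ {A B} → LiteralDisjunction A → LiteralDisjunction B → LiteralDisjunction (A ∨ B)

-- Rejected a₀ A : A is rejected in HAR with the fixed name variable a₀.

data Rejected (a₀ : Name) : L₁ → Set where
  rej-ε  : Rejected a₀ (ε a₀ a₀)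
  rej-∼ε : Rejected a₀ (∼ ε a₀ a₀)
  rej-mp : ∀ {A B} → ⊢ A ⊃ B → Rejected a₀ B → Rejected a₀ A
  rej-sub : ∀ ρ B → Rejected a₀ (rename ρ B) → Rejected a₀ B
  rej-∨  : ∀ {A} a b → Hintikka A → LiteralDisjunction A → Rejected a₀ A →
           ¬ NegPart (ε a b) A → Rejected a₀ (A ∨ ε a b)

{-# OPTIONS --safe #-}

-- A Hintikka formula H propositionally entails the disjunction A of its literal
-- parts (its negative atomic parts negated, its positive atomic parts as they
-- are), so by rej-mp it suffices to reject A.  The negated atoms alone are
-- rejected by identifying all names with a₀; the positive atoms are then added
-- one at a time by rej-∨, every intermediate disjunction being again a Hintikka
-- formula because it has the same negative atomic parts as H.

module Submission where

open import Data.Bool.Base as Bool using (Bool; true; false)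
open import Data.Bool.Properties using (∨-conicalˡ; ∨-conicalʳ; ∨-zeroʳ; not-injective)
open import Data.List.Base using (List; []; _∷_; _++_; [_])
open import Data.List.Membership.Propositional using (_∈_)
open import Data.List.Membership.Propositional.Properties using (∈-++⁺ˡ; ∈-++⁺ʳ; ∈-++⁻)
open import Data.List.Properties using (++-identityʳ)
open import Data.List.Relation.Unary.Any using (here; there)
open import Data.Nat.Base using (ℕ; zero; suc; _+_)
open import Data.Nat.Properties using (+-suc; +-identityʳ; suc-injective)
open import Data.Product.Base using (_×_; _,_; proj₁; proj₂; ∃-syntax)
open import Data.Sum.Base using (inj₁; inj₂)
open import Function.Base using (_∘_; const)
open import Relation.Binary.PropositionalEquality using (_≡_; refl; sym; trans; cong; cong₂; subst)
open import Relation.Nullary.Negation.Core using (¬_; contradiction)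

open import Defs

private
  variable
    X Y : Set
    A B H : L₁
    s t : Sign
    x : Name × Name

-- Derivability of classically valid formulas.

eval-substitute : ∀ (v : Y → Bool) (σ : X → Formula Y) F →
                  eval v (substitute σ F) ≡ eval (eval v ∘ σ) F
eval-substitute v σ (atom x) = refl
eval-substitute v σ (F ∨ G)  = cong₂ Bool._∨_ (eval-substitute v σ F) (eval-substitute v σ G)
eval-substitute v σ (∼ F)    = cong Bool.not (eval-substitute v σ F)

substitute-retract : ∀ (f : X → Y) (g : Y → X) → (∀ x → g (f x) ≡ x) → ∀ F →
                     substitute (atom ∘ g) (substitute (atom ∘ f) F) ≡ F
substitute-retract f g gf (atom x) = cong atom (gf x)
substitute-retract f g gf (F ∨ G)  = cong₂ _∨_ (substitute-retract f g gf F) (substitute-retract f g gf G)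
substitute-retract f g gf (∼ F)    = cong ∼_ (substitute-retract f g gf F)

-- One step of Cantor's walk: an antidiagonal is traversed from `(d , 0)` to `(0 , d)`, then the
-- walk jumps to `(suc d , 0)`.
next : ℕ × ℕ → ℕ × ℕ
next (zero  , b) = suc b , zero
next (suc a , b) = a , suc b

decode : ℕ → ℕ × ℕ
decode zero    = zero , zero
decode (suc n) = next (decode n)

-- The walk is traced backwards. The index `d` is there for termination: it drops at each jump, and
-- along an antidiagonal `b` drops.
decode-onto-diagonal : ∀ d a b → a + b ≡ d → ∃[ n ] decode n ≡ (a , b)
decode-onto-diagonal d zero zero _ = zero , refl
decode-onto-diagonal (suc d) (suc a) zero eq =
  let n , p = decode-onto-diagonal d zero a (trans (sym (+-identityʳ a)) (suc-injective eq))
  in suc n , cong next p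
decode-onto-diagonal d a (suc b) eq =
  let n , p = decode-onto-diagonal d (suc a) b (trans (sym (+-suc a b)) eq)
  in suc n , cong next p

decode-surjective : ∀ x → ∃[ n ] decode n ≡ x
decode-surjective (a , b) = decode-onto-diagonal (a + b) a b refl

encode : ℕ × ℕ → ℕ
encode = proj₁ ∘ decode-surjective

-- `taut` accepts only tautologies over `ℕ`, so the atoms of `A` are coded as numbers; substituting
-- decoded atoms gives `A` back because `decode` inverts `encode` on the left.
⊢-valid : ∀ A → (∀ v → eval v A ≡ true) → ⊢ A
⊢-valid A valid = subst ⊢_ (substitute-retract encode decode (proj₂ ∘ decode-surjective) A)
  (taut (substitute (atom ∘ encode) A)
        (λ v → trans (eval-substitute v (atom ∘ encode) A) (valid (v ∘ encode)))
        (atom ∘ decode))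

⊢-entails : ∀ A B → (∀ v → eval v B ≡ false → eval v A ≡ false) → ⊢ A ⊃ B
⊢-entails A B entails = ⊢-valid (A ⊃ B) valid
  where
  valid : ∀ v → eval v (A ⊃ B) ≡ true
  valid v with eval v B in eq
  ... | true  = ∨-zeroʳ _
  ... | false rewrite entails v eq = refl

-- Truth values of parts, and rejection by identifying all names.

-- The truth value of a part of the given sign when the whole formula is false.
value : Sign → Bool
value pos = false
value neg = true

part-value : ∀ v → eval v A ≡ false → Part A s B → eval v B ≡ value s
part-value v f whole  = f
part-value v f (∨ˡ p) = ∨-conicalˡ _ _ (part-value v f p)
part-value v f (∨ʳ p) = ∨-conicalʳ _ _ (part-value v f p)
part-value v f (∼⁺ p) = not-injective (part-value v f p)
part-value v f (∼⁻ p) = not-injective (part-value v f p)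

-- Truth lemma, by induction on `B`. Values propagate up from the atoms; at a negative disjunction,
-- which `Part` does not decompose, `neg-∨` supplies a true disjunct.
hintikka-part-value : Hintikka H → ∀ v → (∀ t {x} → Part H t (atom x) → v x ≡ value t) →
                      ∀ {s} B → Part H s B → eval v B ≡ value s
hintikka-part-value h v lits {s} (atom x) p = lits s p
hintikka-part-value h v lits {pos} (B ∨ C) p
  rewrite hintikka-part-value h v lits B (∨ˡ p) = hintikka-part-value h v lits C (∨ʳ p)
hintikka-part-value h v lits {neg} (B ∨ C) p with Hintikka.neg-∨ h B C p
... | inj₁ q rewrite hintikka-part-value h v lits B q = refl
... | inj₂ q rewrite hintikka-part-value h v lits C q = ∨-zeroʳ _
hintikka-part-value h v lits {pos} (∼ B) p = cong Bool.not (hintikka-part-value h v lits B (∼⁺ p))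
hintikka-part-value h v lits {neg} (∼ B) p = cong Bool.not (hintikka-part-value h v lits B (∼⁻ p))

hintikka-false : Hintikka H → ∀ v → (∀ t {x} → Part H t (atom x) → v x ≡ value t) →
                 eval v H ≡ false
hintikka-false h v lits = hintikka-part-value h v lits _ whole

hintikka-entails : Hintikka H → (∀ t {x} → Part H t (atom x) → Part A t (atom x)) → ⊢ H ⊃ A
hintikka-entails h incl =
  ⊢-entails _ _ λ v f → hintikka-false h v λ t p → part-value v f (incl t p)

-- Under `const a₀` every atom becomes `ε a₀ a₀`. Where this is false, all atomic parts have the
-- value demanded by `hintikka-false`, so the renamed formula entails `ε a₀ a₀`.
reject-without-neg : ∀ a₀ → Hintikka H → (∀ {x} → ¬ NegPart (atom x) H) → Rejected a₀ H
reject-without-neg {H} a₀ h no-neg =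
  rej-sub (const a₀) H (rej-mp (⊢-entails _ _ entails) rej-ε)
  where
  entails : ∀ v → v (a₀ , a₀) ≡ false → eval v (rename (const a₀) H) ≡ false
  entails v f = trans (eval-substitute v _ H) (hintikka-false h _ λ where
    pos _ → f
    neg p → contradiction p no-neg)

-- The dual collapse: all atomic parts are negative, so making `ε a₀ a₀` true falsifies the renamed
-- formula.
reject-without-pos : ∀ a₀ → Hintikka H → (∀ {x} → ¬ PosPart (atom x) H) → Rejected a₀ H
reject-without-pos {H} a₀ h no-pos =
  rej-sub (const a₀) H (rej-mp (⊢-entails _ _ entails) rej-∼ε)
  where
  entails : ∀ v → Bool.not (v (a₀ , a₀)) ≡ false → eval v (rename (const a₀) H) ≡ false
  entails v f = trans (eval-substitute v _ H) (hintikka-false h _ λ where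
    pos p → contradiction p no-pos
    neg _ → not-injective f)

-- Transfer of the Hintikka conditions to literal disjunctions.

⊑-atom : {p : Part H s B} {q : Part H t (atom x)} → p ⊑ q → s ≡ t × B ≡ atom x
⊑-atom ⊑-refl = refl , refl
⊑-atom (⊑-∨ˡ i) with ⊑-atom i
... | _ , ()
⊑-atom (⊑-∨ʳ i) with ⊑-atom i
... | _ , ()
⊑-atom (⊑-∼⁺ i) with ⊑-atom i
... | _ , ()
⊑-atom (⊑-∼⁻ i) with ⊑-atom i
... | _ , ()

-- Nothing lies properly inside an atom, so overlapping atomic occurrences have the same sign; two
-- of opposite sign would therefore form a clash.
atoms-disjoint : Hintikka H → PosPart (atom x) H → ¬ NegPart (atom x) H
atoms-disjoint h p q = Hintikka.no-clash h (_ , p , q , λ where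
  (inj₁ i) → contradiction (proj₁ (⊑-atom i)) λ ()
  (inj₂ i) → contradiction (proj₁ (⊑-atom i)) λ ())

-- The invariant carried along an occurrence in a literal disjunction: a negation is entered only at
-- some `∼ ε a b`, where the descent ends.
LiteralPart : Sign → L₁ → Set
LiteralPart pos B = LiteralDisjunction B
LiteralPart neg B = ∃[ x ] B ≡ atom x

literal-part : LiteralDisjunction A → Part A s B → LiteralPart s B
literal-part l whole = l
literal-part l (∨ˡ p) with literal-part l p
... | m ∨ _ = m
literal-part l (∨ʳ p) with literal-part l p
... | _ ∨ m = m
literal-part l (∼⁺ p) with literal-part l p
... | lit⁻ a b = (a , b) , refl
literal-part l (∼⁻ p) with literal-part l p
... | _ , ()

hintikka-literals : Hintikka H → LiteralDisjunction A →
                    (∀ t {x} → Part A t (atom x) → Part H t (atom x)) →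
                    (∀ {x} → NegPart (atom x) H → NegPart (atom x) A) →
                    Hintikka A
hintikka-literals {A = A} h l to from = record
  { no-clash = no-clash
  ; neg-∨    = λ B C p → contradiction (proj₂ (literal-part l p)) λ ()
  ; neg-ε₁   = λ a b p → from (neg-ε₁ a b (to neg p))
  ; neg-ε₂   = λ a b c p q → from (neg-ε₂ a b c (to neg p) (to neg q))
  ; neg-ε₃   = λ a b p q → from (neg-ε₃ a b (to neg p) (to neg q))
  }
  where
  open Hintikka h using (neg-ε₁; neg-ε₂; neg-ε₃)
  no-clash : ¬ Clash A
  -- The negative part is an atom, so a clash would make it an atomic part of `H` with both signs.
  no-clash (B , p , q , _) with literal-part l q
  ... | x , refl = atoms-disjoint h (to pos p) (to neg q)

-- Lists of atomic parts and the disjunctions built from them.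

if-same : Sign → Sign → List X → List X
if-same pos pos xs = xs
if-same pos neg xs = []
if-same neg pos xs = []
if-same neg neg xs = xs

-- The atoms that become parts of sign t when the formula is a part of sign s.
atoms : Sign → Sign → L₁ → List (Name × Name)
atoms s   t (atom x) = if-same s t [ x ]
atoms pos t (B ∨ C)  = atoms pos t B ++ atoms pos t C
atoms neg t (B ∨ C)  = []
atoms pos t (∼ B)    = atoms neg t B
atoms neg t (∼ B)    = atoms pos t B

atoms-sound : ∀ s t B → Part H s B → x ∈ atoms s t B → Part H t (atom x)
atoms-sound pos pos (atom x) p (here refl) = p
atoms-sound neg neg (atom x) p (here refl) = p
atoms-sound pos t (B ∨ C) p i with ∈-++⁻ (atoms pos t B) i
... | inj₁ j = atoms-sound pos t B (∨ˡ p) j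
... | inj₂ j = atoms-sound pos t C (∨ʳ p) j
atoms-sound pos t (∼ B) p i = atoms-sound neg t B (∼⁺ p) i
atoms-sound neg t (∼ B) p i = atoms-sound pos t B (∼⁻ p) i

atoms-of-part : Part H s B → x ∈ atoms s t B → x ∈ atoms pos t H
atoms-of-part whole  i = i
atoms-of-part (∨ˡ p) i = atoms-of-part p (∈-++⁺ˡ i)
atoms-of-part (∨ʳ p) i = atoms-of-part p (∈-++⁺ʳ _ i)
atoms-of-part (∼⁺ p) i = atoms-of-part p i
atoms-of-part (∼⁻ p) i = atoms-of-part p i

atoms-complete : ∀ t → Part H t (atom x) → x ∈ atoms pos t H
atoms-complete pos p = atoms-of-part p (here refl)
atoms-complete neg p = atoms-of-part p (here refl)

-- Head and tail are separate arguments because there is no empty disjunction.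
negated : Name × Name → List (Name × Name) → L₁
negated n []       = ∼ atom n
negated n (m ∷ ns) = ∼ atom n ∨ negated m ns

infixl 6 _∨⋯_

-- Each atom is attached on the outside right, matching the conclusion `A ∨ ε a b` of `rej-∨`.
_∨⋯_ : L₁ → List (Name × Name) → L₁
A ∨⋯ []       = A
A ∨⋯ (p ∷ ps) = (A ∨⋯ ps) ∨ atom p

negated-literals : ∀ n ns → LiteralDisjunction (negated n ns)
negated-literals (a , b) []       = lit⁻ a b
negated-literals (a , b) (m ∷ ns) = lit⁻ a b ∨ negated-literals m ns

∨⋯-literals : LiteralDisjunction A → ∀ ps → LiteralDisjunction (A ∨⋯ ps)
∨⋯-literals l []             = l
∨⋯-literals l ((a , b) ∷ ps) = ∨⋯-literals l ps ∨ lit⁺ a b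

negated-neg : ∀ n ns → atoms pos neg (negated n ns) ≡ n ∷ ns
negated-neg n []       = refl
negated-neg n (m ∷ ns) = cong (n ∷_) (negated-neg m ns)

negated-pos : ∀ n ns → atoms pos pos (negated n ns) ≡ []
negated-pos n []       = refl
negated-pos n (m ∷ ns) = negated-pos m ns

∨⋯-neg : ∀ A ps → atoms pos neg (A ∨⋯ ps) ≡ atoms pos neg A
∨⋯-neg A []       = refl
∨⋯-neg A (p ∷ ps) = trans (++-identityʳ _) (∨⋯-neg A ps)

∨⋯-pos⁻ : ∀ A ps → atoms pos pos A ≡ [] → x ∈ atoms pos pos (A ∨⋯ ps) → x ∈ ps
∨⋯-pos⁻ A [] e i = subst (_ ∈_) e i
∨⋯-pos⁻ A (p ∷ ps) e i with ∈-++⁻ (atoms pos pos (A ∨⋯ ps)) i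
... | inj₁ j           = there (∨⋯-pos⁻ A ps e j)
... | inj₂ (here refl) = here refl

∨⋯-pos⁺ : ∀ A ps → x ∈ ps → PosPart (atom x) (A ∨⋯ ps)
∨⋯-pos⁺ A ps i = atoms-sound pos pos (A ∨⋯ ps) whole (member ps i)
  where
  member : ∀ ps → x ∈ ps → x ∈ atoms pos pos (A ∨⋯ ps)
  member (p ∷ ps) (here refl) = ∈-++⁺ʳ (atoms pos pos (A ∨⋯ ps)) (here refl)
  member (p ∷ ps) (there i)   = ∈-++⁺ˡ (member ps i)

-- Rejection in the presence of a negative atom.

module _ (a₀ : Name) (h : Hintikka H) {n ns} (negs : atoms pos neg H ≡ n ∷ ns) where

  literals : List (Name × Name) → L₁
  literals ps = negated n ns ∨⋯ ps

  neg-atoms : ∀ ps → atoms pos neg (literals ps) ≡ atoms pos neg H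
  neg-atoms ps = trans (∨⋯-neg (negated n ns) ps) (trans (negated-neg n ns) (sym negs))

  neg-from : ∀ ps → NegPart (atom x) H → NegPart (atom x) (literals ps)
  neg-from ps p = atoms-sound pos neg (literals ps) whole
    (subst (_ ∈_) (sym (neg-atoms ps)) (atoms-complete neg p))

  neg-to : ∀ ps → NegPart (atom x) (literals ps) → NegPart (atom x) H
  neg-to ps p = atoms-sound pos neg H whole (subst (_ ∈_) (neg-atoms ps) (atoms-complete neg p))

  pos-to : ∀ ps → PosPart (atom x) (literals ps) → x ∈ ps
  pos-to ps p = ∨⋯-pos⁻ (negated n ns) ps (negated-pos n ns) (atoms-complete pos p)

  literals-disjunction : ∀ ps → LiteralDisjunction (literals ps)
  literals-disjunction = ∨⋯-literals (negated-literals n ns)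

  literals-hintikka : ∀ ps → (∀ {x} → x ∈ ps → PosPart (atom x) H) → Hintikka (literals ps)
  literals-hintikka ps sub = hintikka-literals h (literals-disjunction ps)
    (λ where pos p → sub (pos-to ps p)
             neg p → neg-to ps p)
    (neg-from ps)

  reject-literals : ∀ ps → (∀ {x} → x ∈ ps → PosPart (atom x) H) → Rejected a₀ (literals ps)
  reject-literals [] sub =
    reject-without-pos a₀ (literals-hintikka [] sub) λ p → contradiction (pos-to [] p) λ ()
  reject-literals ((a , b) ∷ ps) sub =
    rej-∨ a b (literals-hintikka ps (sub ∘ there)) (literals-disjunction ps)
      (reject-literals ps (sub ∘ there))
      -- The new atom is positive in `H`, hence not negative there, and `literals ps` has the same
      -- negative atoms as `H`.
      (atoms-disjoint h (sub (here refl)) ∘ neg-to ps)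

  reject-with-neg : Rejected a₀ H
  reject-with-neg = rej-mp
    (hintikka-entails h λ where
      pos p → ∨⋯-pos⁺ (negated n ns) (atoms pos pos H) (atoms-complete pos p)
      neg p → neg-from (atoms pos pos H) p)
    (reject-literals (atoms pos pos H) (atoms-sound pos pos H whole))

theorem3p1 : (a₀ : Name) (H : L₁) → Hintikka H → Rejected a₀ H
theorem3p1 a₀ H h with atoms pos neg H in negs
-- With no negated atom to start the disjunction from, the collapse to `ε a₀ a₀` applies to `H`
-- directly.
... | []     = reject-without-neg a₀ h λ p →
                 contradiction (subst (_ ∈_) negs (atoms-complete neg p)) λ ()
... | n ∷ ns = reject-with-neg a₀ h negs
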